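{- There is an absolute constant $C>0$ such that for all integers $n>4$, all positive integers $a,b$, and every induced subgraph $H$ of the shift graph $G_{n,2}$ that is $K_{a,b}$-free, one has $\chi(H)\leq C\log_2(a+b)$. (That is, $\chi(H)=\mathcal{O}(\log(a+b))$.)
   Context: All graphs are finite, simple and undirected. The shift graph $G_{n,2}$ has as vertices all pairs $(a_1,a_2)$ of integers with $1\leq a_1<a_2\leq n$; two vertices $(a_1,a_2)$ and $(b_1,b_2)$ are adjacent iff $a_2=b_1$ or $b_2=a_1$. $K_{a,b}$ is the complete bipartite graph with parts of sizes $a$ and $b$. A graph is $F$-free if it has no induced subgraph isomorphic to $F$. $\chi$ denotes the chromatic number. -}

module Defs where

open import Data.Bool using (Bool; T)
open import Data.Bool.Properties using (T?; T-irrelevant)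
open import Data.Empty using (⊥)
open import Data.Fin using (Fin; zero; suc)
import Data.Fin.Properties as Fin
open import Data.List using (List; []; _∷_; _++_; map; length; allFin; upTo; cartesianProduct)
import Data.List as List
open import Data.List.Membership.Propositional using (_∈_)
open import Data.List.Membership.Propositional.Properties
  using (∈-map⁺; ∈-++⁺ˡ; ∈-++⁺ʳ; ∈-allFin; ∈-upTo⁺; ∈-cartesianProduct⁺)
open import Data.List.Relation.Unary.All as All using ()
open import Data.List.Relation.Unary.Any using (here; there; index)
open import Data.List.Relation.Unary.Any.Properties using (lookup-index)
open import Data.Nat using (ℕ; zero; suc; _^_; _≤_; _<_; z≤n; s≤s; _≤?_; _<?_; _≟_)
open import Data.Nat.Properties using (≤-irrelevant; ≤-trans; <⇒≤; <-irrefl)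
open import Data.Product using (Σ; ∃; _×_; _,_; proj₁; proj₂)
open import Data.Sum using (_⊎_; inj₁; inj₂; [_,_])
import Data.Sum as Sum
open import Data.Unit using (⊤; tt)
open import Data.Vec using (Vec; []; _∷_; lookup; tabulate)
open import Data.Vec.Properties using (lookup∘tabulate)
open import Function using (_∘_; _↔_; _⇔_; Inverse)
open import Relation.Binary using (Symmetric; Irreflexive; Decidable)
open import Relation.Binary.PropositionalEquality
  using (_≡_; _≢_; refl; sym; trans; cong; cong₂)
open import Relation.Nullary using (¬_; Dec; yes; no; Irrelevant; contradiction)
open import Relation.Nullary.Decidable using (map′; _×-dec_; _⊎-dec_; _→-dec_; ¬?)
import Relation.Unary as U

-- Finiteness is a list containing every vertex (possibly repeatedly).
record Graph : Set₁ where
  infix 4 _~_ _~?_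
  field
    V         : Set
    vertices  : List V
    complete  : ∀ v → v ∈ vertices
    _~_       : V → V → Set
    _~?_      : Decidable _~_
    ~-sym     : Symmetric _~_
    ~-irrefl  : Irreflexive _≡_ _~_

module _ {A : Set} {P : A → Set} (P? : U.Decidable P) where

  enumΣ : List A → List (Σ A P)
  enumΣ []       = []
  enumΣ (x ∷ xs) with P? x
  ... | yes px = (x , px) ∷ enumΣ xs
  ... | no  _  = enumΣ xs

  ∈-enumΣ : (∀ {x} → Irrelevant (P x)) →
            ∀ {xs x} → x ∈ xs → (px : P x) → (x , px) ∈ enumΣ xs
  ∈-enumΣ irr {y ∷ xs} (here refl) px with P? y
  ... | yes py = here (cong (y ,_) (irr px py))
  ... | no ¬py = contradiction px ¬py
  ∈-enumΣ irr {y ∷ xs} (there x∈xs) px with P? y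
  ... | yes _ = there (∈-enumΣ irr x∈xs px)
  ... | no  _ = ∈-enumΣ irr x∈xs px

induced : (G : Graph) → (Graph.V G → Bool) → Graph
induced G S = record
  { V        = Σ V (T ∘ S)
  ; vertices = enumΣ (T? ∘ S) vertices
  ; complete = λ (v , v∈S) → ∈-enumΣ (T? ∘ S) T-irrelevant (complete v) v∈S
  ; _~_      = λ u v → proj₁ u ~ proj₁ v
  ; _~?_     = λ u v → proj₁ u ~? proj₁ v
  ; ~-sym    = ~-sym
  ; ~-irrefl = λ u≡v → ~-irrefl (cong proj₁ u≡v)
  }
  where open Graph G

record _≅_ (G H : Graph) : Set where
  private
    module G = Graph G
    module H = Graph H
  field
    bijection : G.V ↔ H.V
  open Inverse bijection public using (to)
  field
    adjacency : ∀ u v → (u G.~ v) ⇔ (to u H.~ to v)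

infix 4 _≅_ _-free_

_-free_ : Graph → Graph → Set
F -free G = ¬ (∃ λ (S : Graph.V G → Bool) → induced G S ≅ F)

module _ (G : Graph) where
  open Graph G

  Proper : ∀ {k} → (V → Fin k) → Set
  Proper c = ∀ u v → u ~ v → c u ≢ c v

  Colourable : ℕ → Set
  Colourable k = ∃ λ (c : V → Fin k) → Proper c

  private
    all? : {P : V → Set} → U.Decidable P → Dec (∀ v → P v)
    all? P? = map′ (λ ps v → All.lookup ps (complete v))
                   (λ ps → All.tabulate (λ {v} _ → ps v))
                   (All.all? P? vertices)

    proper? : ∀ {k} (c : V → Fin k) → Dec (Proper c)
    proper? c = all? λ u → all? λ v → (u ~? v) →-dec ¬? (c u Fin.≟ c v)

    anyVec? : ∀ {k} m {P : Vec (Fin k) m → Set} → U.Decidable P → Dec (∃ P)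
    anyVec? zero    P? = map′ ([] ,_) (λ { ([] , p) → p }) (P? [])
    anyVec? (suc m) P? =
      map′ (λ (x , xs , p) → x ∷ xs , p) (λ { (x ∷ xs , p) → x , xs , p })
           (Fin.any? λ x → anyVec? m λ xs → P? (x ∷ xs))

    position : V → Fin (length vertices)
    position v = index (complete v)

    lookup-position : ∀ v → v ≡ List.lookup vertices (position v)
    lookup-position v = lookup-index (complete v)

  colourable? : U.Decidable Colourable
  colourable? k =
    map′ (λ (w , p) → lookup w ∘ position , p)
         (λ (c , p) → tabulate (c ∘ List.lookup vertices) ,
            λ u v u~v eq → p u v u~v (trans (sym (same c u)) (trans eq (same c v))))
         (anyVec? (length vertices) λ w → proper? (lookup w ∘ position))
    where
    same : (c : V → Fin k) → ∀ v →
           lookup (tabulate (c ∘ List.lookup vertices)) (position v) ≡ c v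
    same c v = trans (lookup∘tabulate _ (position v)) (cong c (sym (lookup-position v)))

  colourable-length : Colourable (length vertices)
  colourable-length = position , λ u v u~v eq →
    ~-irrefl (trans (lookup-position u)
               (trans (cong (List.lookup vertices) eq) (sym (lookup-position v)))) u~v

IsLeast : (ℕ → Set) → ℕ → Set
IsLeast P k = P k × (∀ j → P j → k ≤ j)

least : {P : ℕ → Set} → U.Decidable P → ∀ n → P n → ∃ (IsLeast P)
least P? zero    p = zero , p , λ _ _ → z≤n
least P? (suc n) p with P? zero
... | yes p₀ = zero , p₀ , λ _ _ → z≤n
... | no ¬p₀ with least (P? ∘ suc) n p
...   | k , pk , min = suc k , pk , λ where
        zero    p₀ → contradiction p₀ ¬p₀
        (suc j) pj → s≤s (min j pj)

χ-least : ∀ G → ∃ (IsLeast (Colourable G))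
χ-least G = least (colourable? G) _ (colourable-length G)

χ : Graph → ℕ
χ G = proj₁ (χ-least G)

K : ℕ → ℕ → Graph
K a b = record
  { V        = Fin a ⊎ Fin b
  ; vertices = map inj₁ (allFin a) ++ map inj₂ (allFin b)
  ; complete = λ where
      (inj₁ i) → ∈-++⁺ˡ (∈-map⁺ inj₁ (∈-allFin i))
      (inj₂ j) → ∈-++⁺ʳ (map inj₁ (allFin a)) (∈-map⁺ inj₂ (∈-allFin j))
  ; _~_      = Adj
  ; _~?_     = adj?
  ; ~-sym    = λ {u} {v} → adj-sym u v
  ; ~-irrefl = λ { {inj₁ _} refl () ; {inj₂ _} refl () }
  }
  where
  Adj : Fin a ⊎ Fin b → Fin a ⊎ Fin b → Set
  Adj (inj₁ _) (inj₁ _) = ⊥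
  Adj (inj₁ _) (inj₂ _) = ⊤
  Adj (inj₂ _) (inj₁ _) = ⊤
  Adj (inj₂ _) (inj₂ _) = ⊥

  adj? : Decidable Adj
  adj? (inj₁ _) (inj₁ _) = no λ ()
  adj? (inj₁ _) (inj₂ _) = yes tt
  adj? (inj₂ _) (inj₁ _) = yes tt
  adj? (inj₂ _) (inj₂ _) = no λ ()

  adj-sym : ∀ u v → Adj u v → Adj v u
  adj-sym (inj₁ _) (inj₂ _) _ = tt
  adj-sym (inj₂ _) (inj₁ _) _ = tt

IsShiftVertex : ℕ → ℕ × ℕ → Set
IsShiftVertex n (a₁ , a₂) = 1 ≤ a₁ × a₁ < a₂ × a₂ ≤ n

isShiftVertex? : ∀ n → U.Decidable (IsShiftVertex n)
isShiftVertex? n (a₁ , a₂) = 1 ≤? a₁ ×-dec a₁ <? a₂ ×-dec a₂ ≤? n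

isShiftVertex-irrelevant : ∀ {n p} → Irrelevant (IsShiftVertex n p)
isShiftVertex-irrelevant (p , q , r) (p′ , q′ , r′) =
  cong₂ _,_ (≤-irrelevant p p′) (cong₂ _,_ (≤-irrelevant q q′) (≤-irrelevant r r′))

ShiftAdj : ℕ × ℕ → ℕ × ℕ → Set
ShiftAdj (a₁ , a₂) (b₁ , b₂) = a₂ ≡ b₁ ⊎ b₂ ≡ a₁

shiftGraph : ℕ → Graph
shiftGraph n = record
  { V        = Σ (ℕ × ℕ) (IsShiftVertex n)
  ; vertices = enumΣ (isShiftVertex? n) (cartesianProduct (upTo (suc n)) (upTo (suc n)))
  ; complete = λ (_ , v@(_ , a₁<a₂ , a₂≤n)) →
      ∈-enumΣ (isShiftVertex? n) (λ {p} → isShiftVertex-irrelevant {n} {p})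
        (∈-cartesianProduct⁺ (∈-upTo⁺ (s≤s (≤-trans (<⇒≤ a₁<a₂) a₂≤n)))
                             (∈-upTo⁺ (s≤s a₂≤n)))
        v
  ; _~_      = λ u v → ShiftAdj (proj₁ u) (proj₁ v)
  ; _~?_     = λ ((a₁ , a₂) , _) ((b₁ , b₂) , _) → (a₂ ≟ b₁) ⊎-dec (b₂ ≟ a₁)
  ; ~-sym    = Sum.swap
  ; ~-irrefl = λ { {_ , _ , a₁<a₂ , _} refl →
      [ (λ a₂≡a₁ → <-irrefl (sym a₂≡a₁) a₁<a₂) , (λ a₂≡a₁ → <-irrefl (sym a₂≡a₁) a₁<a₂) ] }
  }

-- The real inequality k ≤ C log₂ m (for m ≥ 1), exponentiated to base 2.
-- A natural C loses nothing in "some constant C > 0": for m ≥ 2 we have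
-- log₂ m > 0, so a real constant may be rounded up.
infix 4 _≤_·log₂_

_≤_·log₂_ : ℕ → ℕ → ℕ → Set
k ≤ C ·log₂ m = 2 ^ k ≤ m ^ C

{-# OPTIONS --safe #-}
-- A vertex subset of the shift graph is a set of arcs x → y (x < y) of an acyclic digraph on
-- {1, …, n}, and two vertices are adjacent iff the head of one arc is the tail of the other.
-- The arcs into v and the arcs out of v induce a complete bipartite graph, so K_{a,b}-freeness
-- makes every v have in-degree < a or out-degree < b.  Colouring the former vertices greedily
-- from left to right with a colours and the latter from right to left with b other colours
-- gives endpoints of every arc distinct colours among a + b.  Writing the colours with
-- k = ⌈log₂ (a + b)⌉ bits and assigning to an arc a position at which its endpoints differ,
-- together with the bit of its tail there, is a proper colouring with 2k colours.
module Submission where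

open import Defs
open import Data.Bool using (Bool; T)
open import Data.Bool.Properties using (T?; T-irrelevant)
open import Data.Fin using (Fin; zero; suc; combine; finToFun; funToFin; inject≤; join; splitAt)
import Data.Fin.Properties as Fin
open import Data.List using (List; map; length; filter; lookup; upTo)
open import Data.List.Membership.Propositional using (_∈_; _∉_)
open import Data.List.Membership.Propositional.Properties
  using (∈-map⁺; ∈-lookup; ∈-filter⁺; ∈-filter⁻; ∈-upTo⁺)
open import Data.List.Membership.Setoid.Properties using (index-injective)
import Data.List.Membership.DecPropositional as DecMembership
open import Data.List.Properties using (length-map)
open import Data.List.Relation.Unary.All as All using ()
open import Data.List.Relation.Unary.AllPairs using (_∷_)
open import Data.List.Relation.Unary.Any as Any using (any?; satisfied)
open import Data.List.Relation.Unary.Unique.Propositional using (Unique)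
import Data.List.Relation.Unary.Unique.Propositional.Properties as Unique
open import Data.Nat
  using (ℕ; zero; suc; _+_; _*_; _∸_; _^_; _≤_; _<_; _>_; z≤n; s≤s; s≤s⁻¹; _≤?_; _<?_; _≟_)
open import Data.Nat.Properties
open import Data.Product using (Σ; ∃; _×_; _,_; proj₁; proj₂)
import Data.Product.Properties as Product
open import Data.Sum using (_⊎_; inj₁; inj₂; [_,_])
open import Data.Sum.Properties using (inj₁-injective; inj₂-injective)
open import Data.Unit using (tt)
open import Function using (_∘_; mk↔ₛ′; mk⇔; _⇔_; Equivalence; Injective)
open import Relation.Binary using (DecidableEquality)
open import Relation.Binary.PropositionalEquality
  using (_≡_; _≢_; refl; sym; trans; cong; cong₂; subst; subst₂; setoid)
open import Relation.Nullary using (¬_; Dec; yes; no; contradiction)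
open import Relation.Nullary.Decidable using (toWitness; fromWitness; isYes; map′)

-- Induced copies from embeddings.

-- The image of `f` is the forbidden vertex set. Searching the vertex list of `F` makes it
-- `Bool`-valued, and the vertex that the search finds gives the inverse map.
embedding⇒¬free : ∀ {F G} → DecidableEquality (Graph.V G) →
                  (f : Graph.V F → Graph.V G) → Injective _≡_ _≡_ f →
                  (∀ u v → Graph._~_ F u v ⇔ Graph._~_ G (f u) (f v)) →
                  ¬ (F -free G)
embedding⇒¬free {F} {G} _≟ᴳ_ f f-inj f-adj free = free (S , record
  { bijection = mk↔ₛ′ to from (λ u → f-inj (f∘to (from u)))
                  (λ p → Σ-≡ (f∘to p))
  ; adjacency = λ u v → mk⇔
      (λ u~v → Equivalence.from (f-adj (to u) (to v)) (subst₂ G._~_ (sym (f∘to u)) (sym (f∘to v)) u~v))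
      (λ u~v → subst₂ G._~_ (f∘to u) (f∘to v) (Equivalence.to (f-adj (to u) (to v)) u~v))
  })
  where
  module F = Graph F
  module G = Graph G

  image? : ∀ v → Dec (Any.Any (λ u → f u ≡ v) F.vertices)
  image? v = any? (λ u → f u ≟ᴳ v) F.vertices

  S : G.V → Bool
  S = isYes ∘ image?

  preimage : ((v , _) : Σ G.V (T ∘ S)) → ∃ λ u → f u ≡ v
  preimage (v , v∈S) = satisfied (toWitness {a? = image? v} v∈S)

  to : Σ G.V (T ∘ S) → F.V
  to = proj₁ ∘ preimage

  f∘to : ∀ p → f (to p) ≡ proj₁ p
  f∘to = proj₂ ∘ preimage

  from : F.V → Σ G.V (T ∘ S)
  from u = f u , fromWitness {a? = image? (f u)} (Any.map (cong f ∘ sym) (F.complete u))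

  Σ-≡ : ∀ {p q : Σ G.V (T ∘ S)} → proj₁ p ≡ proj₁ q → p ≡ q
  Σ-≡ {_ , s} {_ , t} refl = cong (_ ,_) (T-irrelevant s t)

-- Greedy colouring.

lookup-injective : ∀ {A : Set} {xs : List A} → Unique xs → Injective _≡_ _≡_ (lookup xs)
lookup-injective (x∉ ∷ u) {zero}  {zero}  _  = refl
lookup-injective (x∉ ∷ u) {zero}  {suc j} eq = contradiction eq (All.lookup x∉ (∈-lookup j))
lookup-injective (x∉ ∷ u) {suc i} {zero}  eq = contradiction (sym eq) (All.lookup x∉ (∈-lookup i))
lookup-injective (x∉ ∷ u) {suc i} {suc j} eq = cong suc (lookup-injective u eq)

-- Otherwise positions in `xs` would inject `Fin k` into `Fin (length xs)`.
fresh : ∀ {k} (xs : List (Fin k)) → length xs < k → ∃ λ i → i ∉ xs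
fresh {k} xs len = Fin.¬∀⟶∃¬ k (_∈ xs) (_∈? xs) λ all∈ →
  <⇒≱ len (Fin.injective⇒≤ λ {i} {j} → index-injective (setoid _) (all∈ i) (all∈ j))
  where open DecMembership Fin._≟_ using (_∈?_)

-- `N y` plays the neighbours coloured before `y`. Passing from `m` to `suc m` recolours each `y` of
-- rank at least `m` with a short list, avoiding the old colours on `N y`. If `y` has rank at most
-- `m`, everything in `N y` has rank below `m` and keeps its old colour.
greedy : ∀ {X : Set} {k} (N : X → List X) (rank : X → ℕ) →
         (∀ {x y} → x ∈ N y → rank x < rank y) →
         ∀ m → ∃ λ (c : X → Fin (suc k)) →
           ∀ {x y} → rank y < m → length (N y) < suc k → x ∈ N y → c x ≢ c y
greedy N rank decr zero = (λ _ → zero) , λ ()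
greedy {X} {k} N rank decr (suc m) = c′ , proper′
  where
  c : X → Fin (suc k)
  c = proj₁ (greedy N rank decr m)

  proper : ∀ {x y} → rank y < m → length (N y) < suc k → x ∈ N y → c x ≢ c y
  proper = proj₂ (greedy N rank decr m)

  free-colour : ∀ y → length (N y) < suc k → ∃ λ i → i ∉ map c (N y)
  free-colour y len = fresh (map c (N y)) (subst (_< suc k) (sym (length-map c (N y))) len)

  c′ : X → Fin (suc k)
  c′ y with rank y <? m | length (N y) <? suc k
  ... | no _ | yes len = proj₁ (free-colour y len)
  -- Either `y` is already settled, or `N y` is too long and any colour will do, since nothing is
  -- claimed at such a `y`.
  ... | _    | _       = c y

  c′-old : ∀ {y} → rank y < m → c′ y ≡ c y
  c′-old {y} r<m with rank y <? m | length (N y) <? suc k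
  ... | yes _   | _ = refl
  ... | no  r≮m | _ = contradiction r<m r≮m

  c≢c′ : ∀ {x y} → length (N y) < suc k → x ∈ N y → c x ≢ c′ y
  c≢c′ {x} {y} len x∈N eq with rank y <? m | length (N y) <? suc k
  ... | _       | no  len≮ = len≮ len
  ... | yes r<m | yes _    = proper r<m len x∈N eq
  ... | no  _   | yes len′ =
    proj₂ (free-colour y len′) (subst (_∈ map c (N y)) eq (∈-map⁺ c x∈N))

  proper′ : ∀ {x y} → rank y < suc m → length (N y) < suc k → x ∈ N y → c′ x ≢ c′ y
  proper′ r<1+m len x∈N eq =
    c≢c′ len x∈N (trans (sym (c′-old (≤-trans (decr x∈N) (s≤s⁻¹ r<1+m)))) eq)

-- Binary digits and logarithms.

-- The hypothesis is pointwise, so `funToFin` must be shown to respect pointwise equality before it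
-- can invert `finToFun`.
finToFun-injective : ∀ {m k} {i j : Fin (m ^ k)} →
                     (∀ l → finToFun {m} {k} i l ≡ finToFun {m} {k} j l) → i ≡ j
finToFun-injective {m} {k} {i} {j} eq =
  trans (sym (Fin.funToFin-finToFin {k} {m} i))
    (trans (funToFin-cong eq) (Fin.funToFin-finToFin {k} {m} j))
  where
  funToFin-cong : ∀ {k} {f g : Fin k → Fin m} → (∀ l → f l ≡ g l) → funToFin f ≡ funToFin g
  funToFin-cong {zero}  _  = refl
  funToFin-cong {suc k} eq = cong₂ combine (eq zero) (funToFin-cong (eq ∘ suc))

⌈log₂⌉-bounds : ∀ m → ∃ λ k → suc m ≤ 2 ^ k × 2 ^ k ≤ 2 * suc m
⌈log₂⌉-bounds zero    = 0 , s≤s z≤n , s≤s z≤n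
⌈log₂⌉-bounds (suc m) with ⌈log₂⌉-bounds m
... | k , lower , upper with suc (suc m) ≤? 2 ^ k
...   | yes p = k , p , ≤-trans upper (*-monoʳ-≤ 2 (n≤1+n (suc m)))
-- Doubling adds `2 ^ k ≥ 1` to the old bound, enough for the new one; failure of the test keeps
-- `2 ^ k` small enough for the upper bound.
...   | no ¬p = suc k , +-mono-≤ (m^n>0 2 k) (≤-trans lower (m≤m+n (2 ^ k) 0))
                      , *-monoʳ-≤ 2 (<⇒≤ (≰⇒> ¬p))

-- Arcs and degrees.

module _ {n : ℕ} (S : Graph.V (shiftGraph n) → Bool) where

  private
    H : Graph
    H = induced (shiftGraph n) S

  Arc : ℕ → ℕ → Set
  Arc x y = Σ (IsShiftVertex n (x , y)) λ p → T (S ((x , y) , p))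

  arc? : ∀ x y → Dec (Arc x y)
  arc? x y with isShiftVertex? n (x , y)
  ... | no ¬p = no (¬p ∘ proj₁)
  ... | yes p = map′ (p ,_)
      -- `S` also takes the validity proof of a vertex, so membership is moved from `q` to `p`.
      (λ (q , t) → subst (λ r → T (S (_ , r))) (isShiftVertex-irrelevant {n} {x , y} q p) t)
      (T? (S (_ , p)))

  arc⇒< : ∀ {x y} → Arc x y → x < y
  arc⇒< ((_ , x<y , _) , _) = x<y

  arc⇒≤n : ∀ {x y} → Arc x y → y ≤ n
  arc⇒≤n ((_ , _ , y≤n) , _) = y≤n

  vertex : ∀ {x y} → Arc x y → Graph.V H
  vertex (p , t) = (_ , p) , t

  endpoints : Graph.V H → ℕ × ℕ
  endpoints = proj₁ ∘ proj₁

  endpoints-injective : Injective _≡_ _≡_ endpoints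
  endpoints-injective {(e , p) , s} {(_ , q) , t} refl
    with refl ← isShiftVertex-irrelevant {n} {e} p q = cong (_ ,_) (T-irrelevant s t)

  _≟ⱽ_ : DecidableEquality (Graph.V H)
  u ≟ⱽ v = map′ endpoints-injective (cong endpoints)
                (Product.≡-dec _≟_ _≟_ (endpoints u) (endpoints v))

  N⁻ N⁺ : ℕ → List ℕ
  N⁻ y = filter (λ x → arc? x y) (upTo (suc n))
  N⁺ x = filter (arc? x) (upTo (suc n))

  ∈-N⁻⁺ : ∀ {x y} → Arc x y → x ∈ N⁻ y
  ∈-N⁻⁺ {y = y} e = ∈-filter⁺ (λ x → arc? x y) (∈-upTo⁺ (s≤s (≤-trans (<⇒≤ (arc⇒< e)) (arc⇒≤n e)))) e

  ∈-N⁻⁻ : ∀ {x y} → x ∈ N⁻ y → Arc x y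
  ∈-N⁻⁻ {y = y} = proj₂ ∘ ∈-filter⁻ (λ x → arc? x y) {xs = upTo (suc n)}

  ∈-N⁺⁺ : ∀ {x y} → Arc x y → y ∈ N⁺ x
  ∈-N⁺⁺ {x} e = ∈-filter⁺ (arc? x) (∈-upTo⁺ (s≤s (arc⇒≤n e))) e

  ∈-N⁺⁻ : ∀ {x y} → y ∈ N⁺ x → Arc x y
  ∈-N⁺⁻ {x} = proj₂ ∘ ∈-filter⁻ (arc? x) {xs = upTo (suc n)}

  -- Two arcs into `v` are never adjacent: one of them would have tail `v` as well as head `v`. The
  -- same holds for two arcs out of `v`.
  degrees⇒¬free : ∀ {a b} v → a ≤ length (N⁻ v) → b ≤ length (N⁺ v) → ¬ (K a b -free H)
  degrees⇒¬free {a} {b} v a≤ b≤ = embedding⇒¬free {K a b} {H} _≟ⱽ_ f f-inj f-adj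
    where
    tail : Fin a → ℕ
    tail i = lookup (N⁻ v) (inject≤ i a≤)

    head : Fin b → ℕ
    head j = lookup (N⁺ v) (inject≤ j b≤)

    in-arc : ∀ i → Arc (tail i) v
    in-arc i = ∈-N⁻⁻ (∈-lookup (inject≤ i a≤))

    out-arc : ∀ j → Arc v (head j)
    out-arc j = ∈-N⁺⁻ (∈-lookup (inject≤ j b≤))

    f : Fin a ⊎ Fin b → Graph.V H
    f = [ vertex ∘ in-arc , vertex ∘ out-arc ]

    unique : ∀ {P : ℕ → Set} (P? : ∀ x → Dec (P x)) → Unique (filter P? (upTo (suc n)))
    unique P? = Unique.filter⁺ P? (Unique.upTo⁺ (suc n))

    f-inj : Injective _≡_ _≡_ f
    f-inj {inj₁ i} {inj₁ j} eq = cong inj₁ (Fin.inject≤-injective a≤ a≤ i j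
      (lookup-injective (unique (λ x → arc? x v)) (cong (proj₁ ∘ endpoints) eq)))
    f-inj {inj₂ i} {inj₂ j} eq = cong inj₂ (Fin.inject≤-injective b≤ b≤ i j
      (lookup-injective (unique (arc? v)) (cong (proj₂ ∘ endpoints) eq)))
    f-inj {inj₁ i} {inj₂ j} eq =
      contradiction (cong (proj₁ ∘ endpoints) eq) (<⇒≢ (arc⇒< (in-arc i)))
    f-inj {inj₂ i} {inj₁ j} eq =
      contradiction (cong (proj₁ ∘ endpoints) (sym eq)) (<⇒≢ (arc⇒< (in-arc j)))

    f-adj : ∀ u w → Graph._~_ (K a b) u w ⇔ Graph._~_ H (f u) (f w)
    f-adj (inj₁ i) (inj₁ j) = mk⇔ (λ ())
      [ (λ v≡ → <⇒≢ (arc⇒< (in-arc j)) (sym v≡)) , (λ v≡ → <⇒≢ (arc⇒< (in-arc i)) (sym v≡)) ]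
    f-adj (inj₁ i) (inj₂ j) = mk⇔ (λ _ → inj₁ refl) (λ _ → tt)
    f-adj (inj₂ i) (inj₁ j) = mk⇔ (λ _ → inj₂ refl) (λ _ → tt)
    f-adj (inj₂ i) (inj₂ j) = mk⇔ (λ ())
      [ (λ ≡v → <⇒≢ (arc⇒< (out-arc i)) (sym ≡v)) , (λ ≡v → <⇒≢ (arc⇒< (out-arc j)) (sym ≡v)) ]

  free⇒degrees : ∀ {a b} → K a b -free H → ∀ v → length (N⁻ v) < a ⊎ length (N⁺ v) < b
  free⇒degrees {a} {b} free v with length (N⁻ v) <? a | length (N⁺ v) <? b
  ... | yes p | _     = inj₁ p
  ... | no  _ | yes q = inj₂ q
  ... | no ¬p | no ¬q = contradiction free (degrees⇒¬free v (≮⇒≥ ¬p) (≮⇒≥ ¬q))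

  -- Colouring endpoints, then arcs.

  endpoint-colouring : ∀ {a b} →
    (∀ v → length (N⁻ v) < suc a ⊎ length (N⁺ v) < suc b) →
    ∃ λ (c : ℕ → Fin (suc a + suc b)) → ∀ {x y} → Arc x y → c x ≢ c y
  endpoint-colouring {a} {b} degrees = c , proper
    where
    left : ∃ λ (l : ℕ → Fin (suc a)) →
      ∀ {x y} → y < suc n → length (N⁻ y) < suc a → x ∈ N⁻ y → l x ≢ l y
    left = greedy N⁻ (λ y → y) (arc⇒< ∘ ∈-N⁻⁻) (suc n)

    right : ∃ λ (r : ℕ → Fin (suc b)) →
      ∀ {y x} → n ∸ x < suc n → length (N⁺ x) < suc b → y ∈ N⁺ x → r y ≢ r x
    -- The rank `n ∸_` reverses the order; truncated subtraction is strict here because heads are at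
    -- most `n`.
    right = greedy N⁺ (n ∸_)
      (λ {y} {x} y∈N → let e = ∈-N⁺⁻ {x} {y} y∈N in ∸-monoʳ-< (arc⇒< e) (arc⇒≤n e)) (suc n)

    c⊎ : ℕ → Fin (suc a) ⊎ Fin (suc b)
    c⊎ v = [ (λ _ → inj₁ (proj₁ left v)) , (λ _ → inj₂ (proj₁ right v)) ] (degrees v)

    proper⊎ : ∀ {x y} → Arc x y → c⊎ x ≢ c⊎ y
    proper⊎ {x} {y} e eq with degrees x | degrees y
    -- On the left palette the head was coloured after the tail, so its bound `q` counts; on the
    -- right palette it is the tail's bound `p`. Mixed pairs contradict `eq`.
    ... | inj₁ _ | inj₁ q =
      proj₂ left (s≤s (arc⇒≤n e)) q (∈-N⁻⁺ e) (inj₁-injective eq)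
    ... | inj₂ p | inj₂ _ =
      proj₂ right (s≤s (m∸n≤m n x)) p (∈-N⁺⁺ e) (sym (inj₂-injective eq))

    c : ℕ → Fin (suc a + suc b)
    c = join (suc a) (suc b) ∘ c⊎

    proper : ∀ {x y} → Arc x y → c x ≢ c y
    proper {x} {y} e eq = proper⊎ e
      (trans (sym (Fin.splitAt-join (suc a) (suc b) (c⊎ x)))
        (trans (cong (splitAt (suc a)) eq) (Fin.splitAt-join (suc a) (suc b) (c⊎ y))))

  -- If arcs x → y and y → z had the same colour, they would share a position at which x and y have
  -- equal bits, against the choice of the position for x → y.
  arc-colouring : ∀ {k} (c : ℕ → Fin (2 ^ k)) → (∀ {x y} → Arc x y → c x ≢ c y) →
                  Colourable H (k * 2)
  arc-colouring {k} c proper = colour , λ where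
      u v (inj₁ refl) → clash u v refl
      u v (inj₂ refl) → clash v u refl ∘ sym
    where
    bit : ℕ → Fin k → Fin 2
    bit x = finToFun {2} {k} (c x)

    separator : (e : Graph.V H) →
      ∃ λ i → bit (proj₁ (endpoints e)) i ≢ bit (proj₂ (endpoints e)) i
    separator ((_ , p) , t) = Fin.¬∀⟶∃¬ k _ (λ i → bit _ i Fin.≟ bit _ i)
      (proper (p , t) ∘ finToFun-injective {2} {k})

    colour : Graph.V H → Fin (k * 2)
    colour e = combine i (bit (proj₁ (endpoints e)) i)
      where i = proj₁ (separator e)

    clash : ∀ u v → proj₂ (endpoints u) ≡ proj₁ (endpoints v) → colour u ≢ colour v
    clash u v head≡tail eq
      with i≡j , bits≡ ← Fin.combine-injective (proj₁ (separator u)) _ (proj₁ (separator v)) _ eq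
      = proj₂ (separator u) (trans bits≡ (cong₂ bit (sym head≡tail) (sym i≡j)))

theorem11 : ∃ λ (C : ℕ) → C > 0 ×
    (∀ (n : ℕ) → n > 4 → ∀ (a b : ℕ) → 1 ≤ a → 1 ≤ b →
    ∀ (S : Graph.V (shiftGraph n) → Bool) →
    K a b -free induced (shiftGraph n) S →
    χ (induced (shiftGraph n) S) ≤ C ·log₂ (a + b))
theorem11 = 4 , s≤s z≤n , bound
  where
  bound : ∀ n → n > 4 → ∀ a b → 1 ≤ a → 1 ≤ b →
          ∀ (S : Graph.V (shiftGraph n) → Bool) → K a b -free induced (shiftGraph n) S →
          χ (induced (shiftGraph n) S) ≤ 4 ·log₂ (a + b)
  bound n _ (suc a) (suc b) _ _ S free
    with c , proper ← endpoint-colouring S (free⇒degrees S free)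
       | k , lower , upper ← ⌈log₂⌉-bounds (a + suc b) = begin
    2 ^ χ (induced (shiftGraph n) S)  ≤⟨ ^-monoʳ-≤ 2 (proj₂ (proj₂ (χ-least (induced (shiftGraph n) S))) (k * 2) colouring) ⟩
    2 ^ (k * 2)                       ≡⟨ ^-*-assoc 2 k 2 ⟨
    (2 ^ k) ^ 2                       ≤⟨ ^-monoˡ-≤ 2 upper ⟩
    -- Both parts are nonempty, so `2 ≤ m` and the factor 2 lost in rounding up the logarithm is
    -- absorbed into `m`. Two colours per bit double the exponent again, whence the constant 4.
    (2 * m) ^ 2                       ≤⟨ ^-monoˡ-≤ 2 (*-monoˡ-≤ m 2≤m) ⟩
    (m * m) ^ 2                       ≡⟨ cong (λ t → (m * t) ^ 2) (*-identityʳ m) ⟨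
    (m ^ 2) ^ 2                       ≡⟨ ^-*-assoc m 2 2 ⟩
    m ^ 4                             ∎
    where
    open ≤-Reasoning
    m : ℕ
    m = suc a + suc b

    2≤m : 2 ≤ m
    2≤m = +-mono-≤ {1} {suc a} (s≤s z≤n) (s≤s z≤n)

    colouring : Colourable (induced (shiftGraph n) S) (k * 2)
    colouring = arc-colouring S {k} (λ x → inject≤ (c x) lower)
      (λ e → proper e ∘ Fin.inject≤-injective lower lower _ _)
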